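{- Let $p$ be an odd prime and $k\ge 0$. For every $s\ge 1$, every $0\le l<p^k$ and every $0\le l'<p^{k+1}$, $$\sum_{P\in\mathcal P(V_{s,l})}(-1)^{\mathrm{inv}(P)}=0\qquad\text{and}\qquad \sum_{P\in\mathcal P(W_{s+1,l'})}(-1)^{\mathrm{inv}(P)}=0 .$$
   Context: Fix an odd prime $p$ and an integer $k\ge 0$. For integers $0\le i<n$ write $\lambda(n,i)=(n-i,1^i)$ for the hook partition of $n$ with $n-i$ boxes in its first row and $i$ further boxes in its first column. If $\mu=\lambda(n',i')$ is obtained from $\lambda(n,i)$ by appending $m=(n'-i')-(n-i)\ge 0$ boxes to the first row and $n''=i'-i\ge 0$ boxes to the first column, we say $\mu$ is obtained by adding the block $B_{m,n''}$ ($m$ horizontal nodes, $n''$ vertical nodes). Put $x_s=p^k(sp-(s+1))$. The relevant part ("column $k$") of the $p$-Bratteli diagram is the graded directed graph with vertices: on floor $2k+1$, $S_i=\lambda(p^k(p-1),i)$ for $0\le i<p^k(p-1)$; on floor $2(k+s)$ ($s\ge1$), $V_{s,l}=\lambda\big(p^k(2sp-(2s+1)),\,x_s+l\big)$ for $0\le l<p^k$; on floor $2(k+s)-1$ ($s\ge2$), $W_{s,l'}=\lambda\big(p^k((2s-1)p-2s),\,x_{s-1}+l'\big)$ for $0\le l'<p^{k+1}$; and edges, each labelled by the block added: (E1) $S_i\to V_{1,l}$ exactly when $i=p^kt+l$ with $0\le t\le p-2$, block $B_{p^kt,\,p^k(p-2-t)}$; (E2) for $s\ge2$, $0\le l<p^k$,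 $0\le\beta\le p-1$: $V_{s-1,l}\to W_{s,pl+\beta}$, block $B_{p^k(p-1)-((p-1)l+\beta),\,(p-1)l+\beta}$; (E3) for $s\ge 2$, $0\le l'<p^{k+1}$ and $t=\lfloor l'/p^k\rfloor$: $W_{s,l'}\to V_{s,l'-p^kt}$, block $B_{p^kt,\,p^k(p-1-t)}$. A path ending at a vertex $v$ is a sequence of edges starting at some $S_i$ and going up one floor at a time to $v$ ($S_i\to V_{1,\cdot}\to W_{2,\cdot}\to V_{2,\cdot}\to W_{3,\cdot}\to\cdots\to v$); $\mathcal P(v)$ is the set of all paths ending at $v$. The blocks of a path are numbered $B^2,B^3,\dots,B^N$: $B^2$ is the block of the edge leaving $S_i$, and for $j\ge2$, $B^{2j-1}$ is the block of the edge into $W_{j,\cdot}$ and $B^{2j}$ the block of the edge into $V_{j,\cdot}$. Write $B^j=B_{m_j,n_j}$. Inversions: $(1,2)\in\mathrm{Inv}(P)$ iff $m_2=p^kt$ with $0\le t<\frac{p-1}{2}$; for $3\le i<j\le N$, $(i,j)\in\mathrm{Inv}(P)$ iff $m_i>m_j$ and $n_i<n_j$; no other pairs are inversions. $\mathrm{inv}(P)=|\mathrm{Inv}(P)|$. -}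

module Defs where

open import Data.Bool.Base using (if_then_else_)
open import Data.Empty using (⊥; ⊥-elim)
open import Data.Fin.Base using (Fin; zero; suc; toℕ; fromℕ<; cast; combine; remQuot)
import Data.Fin.Properties as Fin
open import Data.Integer.Base as ℤ using (ℤ; 0ℤ; -1ℤ)
open import Data.List.Base using (List; []; _∷_; map; foldr; concat; tabulate; filter; length; upTo; cartesianProduct)
open import Data.List.Membership.Propositional using (_∈_)
open import Data.List.Membership.Propositional.Properties using (∈-map⁺; ∈-map⁻; ∈-concat⁺′; ∈-tabulate⁺)
import Data.List.Relation.Unary.All as All
import Data.List.Relation.Unary.All.Properties as All
import Data.List.Relation.Unary.AllPairs as AllPairs
import Data.List.Relation.Unary.AllPairs.Properties as AllPairs
open import Data.List.Relation.Unary.Any using (here)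
open import Data.List.Relation.Unary.Unique.Propositional using (Unique)
import Data.List.Relation.Unary.Unique.Propositional.Properties as Unique
open import Data.Maybe.Base using (Maybe; just; nothing)
open import Data.Maybe.Properties using (just-injective)
open import Data.Nat.Base
open import Data.Nat.Divisibility using (_∣_)
open import Data.Nat.DivMod
open import Data.Nat.Primality using (Prime; prime⇒nonZero; prime⇒nonTrivial)
open import Data.Nat.Properties
open import Data.Product.Base using (∃; _×_; _,_; proj₁; proj₂; uncurry)
open import Data.Sum.Base using (_⊎_)
open import Data.Unit.Base using (⊤; tt)
open import Relation.Binary.PropositionalEquality
open import Relation.Nullary using (¬_; Dec; contradiction)
open import Relation.Nullary.Decidable using (_×-dec_; _⊎-dec_; recompute)

record Enumeration (A : Set) : Set where
  field
    list     : List A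
    complete : ∀ x → x ∈ list
    unique   : Unique list

open Enumeration

∑ : {A : Set} → Enumeration A → (A → ℤ) → ℤ
∑ xs f = foldr ℤ._+_ 0ℤ (map f (list xs))

-- The hook partition λ(n,i) = (n - i, 1^i).
record Hook : Set where
  constructor hook
  field
    size      : ℕ
    leg       : ℕ
    .leg<size : leg < size

  arm : ℕ
  arm = size ∸ leg

-- The block B_{m,n}: m horizontal and n vertical nodes.
record Block : Set where
  constructor B
  field
    horizontal : ℕ
    vertical   : ℕ

open Hook
open Block

_⊕_≈_ : Hook → Block → Hook → Set
h ⊕ b ≈ h′ = arm h′ ≡ arm h + horizontal b × leg h′ ≡ leg h + vertical b

private
  ⊕-intro : ∀ h b h′ → size h′ ≡ size h + (horizontal b + vertical b) →
            leg h′ ≡ leg h + vertical b → h ⊕ b ≈ h′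
  ⊕-intro (hook n i i<n) (B a c) (hook n′ i′ _) size-eq leg-eq = arm-eq , leg-eq
    where
    open ≡-Reasoning
    i≤n : i ≤ n
    i≤n = recompute (i ≤? n) (<⇒≤ i<n)
    arm-eq : n′ ∸ i′ ≡ n ∸ i + a
    arm-eq = begin
      n′ ∸ i′                 ≡⟨ cong₂ _∸_ size-eq leg-eq ⟩
      n + (a + c) ∸ (i + c)   ≡⟨ cong₂ _∸_ (trans (sym (+-assoc n a c)) (+-comm (n + a) c)) (+-comm i c) ⟩
      c + (n + a) ∸ (c + i)   ≡⟨ [m+n]∸[m+o]≡n∸o c (n + a) i ⟩
      n + a ∸ i               ≡⟨ +-∸-comm a i≤n ⟩
      n ∸ i + a               ∎

  2≰1 : ¬ 2 ≤ 1
  2≰1 (s≤s ())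

module Column (p : ℕ) (p-prime : Prime p) (p-odd : ¬ 2 ∣ p) (k : ℕ) where

  private instance
    p≢0 : NonZero p
    p≢0 = prime⇒nonZero p-prime

    pᵏ≢0 : NonZero (p ^ k)
    pᵏ≢0 = m^n≢0 p k

  -- For s ≥ 1 all truncated subtractions below are exact.
  x : ℕ → ℕ
  x s = p ^ k * (s * p ∸ (s + 1))

  private
    K : ℕ
    K = p ^ k

    1<p : 1 < p
    1<p = nonTrivial⇒n>1 p {{prime⇒nonTrivial p-prime}}

    r≥1 : 1 ≤ p ∸ 1
    r≥1 = m<n⇒0<n∸m 1<p

    p≡1+r : p ≡ suc (p ∸ 1)
    p≡1+r = sym (m+[n∸m]≡n (<⇒≤ 1<p))

    c : ℕ → ℕ
    c a = a * p ∸ (a + 1)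

    c-eq : ∀ a → c a ≡ a * (p ∸ 1) ∸ 1
    c-eq a = begin
      a * p ∸ (a + 1)                 ≡⟨ cong (λ z → a * z ∸ (a + 1)) p≡1+r ⟩
      a * suc (p ∸ 1) ∸ (a + 1)       ≡⟨ cong (_∸ (a + 1)) (*-suc a (p ∸ 1)) ⟩
      a + a * (p ∸ 1) ∸ (a + 1)       ≡⟨ [m+n]∸[m+o]≡n∸o a _ 1 ⟩
      a * (p ∸ 1) ∸ 1                 ∎
      where open ≡-Reasoning

    c-suc : ∀ a → 1 ≤ a → c (suc a) ≡ c a + (p ∸ 1)
    c-suc a a≥1 = begin
      c (suc a)                       ≡⟨ c-eq (suc a) ⟩
      p ∸ 1 + a * (p ∸ 1) ∸ 1         ≡⟨ cong (_∸ 1) (+-comm (p ∸ 1) _) ⟩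
      a * (p ∸ 1) + (p ∸ 1) ∸ 1       ≡⟨ +-∸-comm (p ∸ 1) (*-mono-≤ a≥1 r≥1) ⟩
      a * (p ∸ 1) ∸ 1 + (p ∸ 1)       ≡⟨ cong (_+ (p ∸ 1)) (c-eq a) ⟨
      c a + (p ∸ 1)                   ∎
      where open ≡-Reasoning

    1+c : ∀ a → 1 ≤ a → c a + 1 ≡ a * (p ∸ 1)
    1+c a a≥1 = trans (cong (_+ 1) (c-eq a)) (m∸n+n≡m (*-mono-≤ a≥1 r≥1))

    2a : ∀ a → 2 * a ≡ a + a
    2a a = cong (a +_) (+-identityʳ a)

    2s≥1 : ∀ s → 1 ≤ s → 1 ≤ 2 * s
    2s≥1 s s≥1 = ≤-trans s≥1 (m≤m+n s _)

    V-hook : ∀ s → 1 ≤ s → (l : Fin (p ^ k)) → x s + toℕ l < p ^ k * (2 * s * p ∸ (2 * s + 1))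
    V-hook s s≥1 l = begin-strict
      K * c s + toℕ l     <⟨ +-monoʳ-< (K * c s) (Fin.toℕ<n l) ⟩
      K * c s + K         ≡⟨ cong (K * c s +_) (*-identityʳ K) ⟨
      K * c s + K * 1     ≡⟨ *-distribˡ-+ K (c s) 1 ⟨
      K * (c s + 1)       ≡⟨ cong (K *_) (1+c s s≥1) ⟩
      K * (s * (p ∸ 1))   ≤⟨ *-monoʳ-≤ K (+-cancelʳ-≤ 1 _ _ le) ⟩
      K * c (2 * s)       ∎
      where
      open ≤-Reasoning
      le : s * (p ∸ 1) + 1 ≤ c (2 * s) + 1
      le = begin
        s * (p ∸ 1) + 1               ≤⟨ +-monoʳ-≤ (s * (p ∸ 1)) (*-mono-≤ s≥1 r≥1) ⟩
        s * (p ∸ 1) + s * (p ∸ 1)     ≡⟨ *-distribʳ-+ (p ∸ 1) s s ⟨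
        (s + s) * (p ∸ 1)             ≡⟨ cong (_* (p ∸ 1)) (2a s) ⟨
        2 * s * (p ∸ 1)               ≡⟨ 1+c (2 * s) (2s≥1 s s≥1) ⟨
        c (2 * s) + 1                 ∎

    2[1+s] : ∀ s → 2 * suc s ≡ 2 + 2 * s
    2[1+s] s = *-suc 2 s

    W-size : ∀ s → p ^ k * ((2 * suc s ∸ 1) * p ∸ 2 * suc s) ≡ K * c (suc (2 * s))
    W-size s = trans (cong (λ z → K * ((z ∸ 1) * p ∸ z)) (2[1+s] s))
      (cong (λ z → K * (suc (2 * s) * p ∸ suc z)) (+-comm 1 (2 * s)))

    W-hook′ : ∀ s → 1 ≤ s → (l′ : Fin (p ^ suc k)) → x s + toℕ l′ < K * c (suc (2 * s))
    W-hook′ s s≥1 l′ = begin-strict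
      K * c s + toℕ l′    <⟨ +-monoʳ-< (K * c s) (Fin.toℕ<n l′) ⟩
      K * c s + p * K     ≡⟨ cong (K * c s +_) (*-comm p K) ⟩
      K * c s + K * p     ≡⟨ *-distribˡ-+ K (c s) p ⟨
      K * (c s + p)       ≤⟨ *-monoʳ-≤ K (+-cancelʳ-≤ 1 _ _ le) ⟩
      K * c (suc (2 * s)) ∎
      where
      open ≤-Reasoning
      r = p ∸ 1
      le : c s + p + 1 ≤ c (suc (2 * s)) + 1
      le = begin
        c s + p + 1         ≡⟨ +-assoc (c s) p 1 ⟩
        c s + (p + 1)       ≡⟨ cong (c s +_) (+-comm p 1) ⟩
        c s + (1 + p)       ≡⟨ +-assoc (c s) 1 p ⟨
        c s + 1 + p         ≡⟨ cong₂ _+_ (1+c s s≥1) p≡1+r ⟩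
        s * r + (1 + r)     ≤⟨ +-monoʳ-≤ (s * r) (+-monoˡ-≤ r (*-mono-≤ s≥1 r≥1)) ⟩
        s * r + (s * r + r) ≡⟨ +-assoc (s * r) _ _ ⟨
        s * r + s * r + r   ≡⟨ cong (_+ r) (*-distribʳ-+ r s s) ⟨
        (s + s) * r + r     ≡⟨ cong (λ z → z * r + r) (2a s) ⟨
        2 * s * r + r       ≡⟨ +-comm _ r ⟩
        suc (2 * s) * r     ≡⟨ 1+c (suc (2 * s)) (s≤s z≤n) ⟨
        c (suc (2 * s)) + 1 ∎

    W-hook : ∀ s → 2 ≤ s → (l′ : Fin (p ^ suc k)) →
             x (s ∸ 1) + toℕ l′ < p ^ k * ((2 * s ∸ 1) * p ∸ 2 * s)
    W-hook (suc s) (s≤s s≥1) l′ = subst (x s + toℕ l′ <_) (sym (W-size s)) (W-hook′ s s≥1 l′)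

  data Vertex : Set where
    S : Fin (p ^ k * (p ∸ 1)) → Vertex
    V : (s : ℕ) → .(1 ≤ s) → Fin (p ^ k) → Vertex
    W : (s : ℕ) → .(2 ≤ s) → Fin (p ^ suc k) → Vertex

  floor : Vertex → ℕ
  floor (S _)     = 2 * k + 1
  floor (V s _ _) = 2 * (k + s)
  floor (W s _ _) = 2 * (k + s) ∸ 1

  shape : Vertex → Hook
  shape (S i)        = hook (p ^ k * (p ∸ 1)) (toℕ i) (Fin.toℕ<n i)
  shape (V s s≥1 l)  = hook (p ^ k * (2 * s * p ∸ (2 * s + 1))) (x s + toℕ l) (V-hook s s≥1 l)
  shape (W s s≥2 l′) = hook (p ^ k * ((2 * s ∸ 1) * p ∸ 2 * s)) (x (s ∸ 1) + toℕ l′) (W-hook s s≥2 l′)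

  infix 4 _⟶_

  -- E2 is indexed by the s of its source V_{s,l}, so its target is W_{s+1,pl+β}.
  data _⟶_ : Vertex → Vertex → Set where
    E1 : (t : Fin (p ∸ 1)) (l : Fin (p ^ k)) (i : Fin (p ^ k * (p ∸ 1))) →
         .(toℕ i ≡ p ^ k * toℕ t + toℕ l) →
         S i ⟶ V 1 ≤-refl l
    E2 : (s : ℕ) .(s≥1 : 1 ≤ s) (l : Fin (p ^ k)) (β : Fin p) (l′ : Fin (p ^ suc k)) →
         .(toℕ l′ ≡ p * toℕ l + toℕ β) →
         V s s≥1 l ⟶ W (suc s) (s≤s s≥1) l′
    E3 : (s : ℕ) .(s≥2 : 2 ≤ s) (l′ : Fin (p ^ suc k)) (l : Fin (p ^ k)) →
         .(toℕ l ≡ toℕ l′ ∸ p ^ k * (toℕ l′ / p ^ k)) →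
         W s s≥2 l′ ⟶ V s (<⇒≤ s≥2) l

  block : ∀ {u v} → u ⟶ v → Block
  block (E1 t l i _)      = B (p ^ k * toℕ t) (p ^ k * (p ∸ 2 ∸ toℕ t))
  block (E2 s _ l β l′ _) = B (p ^ k * (p ∸ 1) ∸ ((p ∸ 1) * toℕ l + toℕ β)) ((p ∸ 1) * toℕ l + toℕ β)
  block (E3 s _ l′ l _)   = let t = toℕ l′ / p ^ k in B (p ^ k * t) (p ^ k * (p ∸ 1 ∸ t))

  infixl 5 _▷_

  data Path : Vertex → Set where
    [_] : ∀ i → Path (S i)
    _▷_ : ∀ {u v} → Path u → u ⟶ v → Path v

  -- The number j carried by the block B^j of any edge into the given vertex.
  -- For a path ending at v it is the last block number N.
  number : Vertex → ℕ
  number (S _)     = 1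
  number (V s _ _) = 2 * s
  number (W s _ _) = 2 * s ∸ 1

  -- The block B^j; the value B 0 0 for j outside 2 ≤ j ≤ N is a dummy.
  blockAt : ∀ {v} → Path v → ℕ → Block
  blockAt [ i ]             j = B 0 0
  blockAt (_▷_ {v = v} P e) j = if j ≡ᵇ number v then block e else blockAt P j

  m n : ∀ {v} → Path v → ℕ → ℕ
  m P j = horizontal (blockAt P j)
  n P j = vertical (blockAt P j)

  Inv : ∀ {v} → Path v → ℕ → ℕ → Set
  Inv {v} P i j =
      (i ≡ 1 × j ≡ 2 × 2 ≤ number v × ∃ λ t → t < (p ∸ 1) / 2 × m P 2 ≡ p ^ k * t)
    ⊎ (3 ≤ i × i < j × j ≤ number v × m P i > m P j × n P i < n P j)

  inv? : ∀ {v} (P : Path v) i j → Dec (Inv P i j)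
  inv? {v} P i j =
          (i ≟ 1 ×-dec j ≟ 2 ×-dec 2 ≤? number v ×-dec anyUpTo? (λ t → m P 2 ≟ p ^ k * t) ((p ∸ 1) / 2))
    ⊎-dec (3 ≤? i ×-dec i <? j ×-dec j ≤? number v ×-dec m P j <? m P i ×-dec n P i <? n P j)

  -- All inversions (i,j) satisfy i, j ≤ N.
  inv : ∀ {v} → Path v → ℕ
  inv {v} P = length (filter (uncurry (inv? P)) (cartesianProduct indices indices))
    where
    indices : List ℕ
    indices = upTo (suc (number v))

  sign : ∀ {v} → Path v → ℤ
  sign P = -1ℤ ℤ.^ inv P

  private
    lastEdge : ∀ {v} → Path v → Maybe (∃ (_⟶ v))
    lastEdge [ _ ]           = nothing
    lastEdge (_▷_ {u} _ e) = just (u , e)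

    ▷-injective : ∀ {u v} {P Q : Path u} {e : u ⟶ v} → P ▷ e ≡ Q ▷ e → P ≡ Q
    ▷-injective refl = refl

    NotSource : Vertex → Set
    NotSource (S _)     = ⊥
    NotSource (V _ _ _) = ⊤
    NotSource (W _ _ _) = ⊤

    extend : ∀ {q v} → NotSource v → (es : Fin q → ∃ (_⟶ v)) →
             (∀ {a b} → es a ≡ es b → a ≡ b) → (∀ e → ∃ λ a → es a ≡ e) →
             (∀ a → Enumeration (Path (proj₁ (es a)))) → Enumeration (Path v)
    extend {q} {v} ns es es-inj es-surj rec = record
      { list     = concat (tabulate group)
      ; complete = compl ns
      ; unique   = Unique.concat⁺
          (All.tabulate⁺ (λ a → Unique.map⁺ ▷-injective (unique (rec a))))
          (AllPairs.tabulate⁺ disjoint)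
      }
      where
      group : Fin q → List (Path v)
      group a = map (_▷ proj₂ (es a)) (list (rec a))

      compl′ : ∀ a e → es a ≡ e → (P : Path (proj₁ e)) → P ▷ proj₂ e ∈ concat (tabulate group)
      compl′ a _ refl P =
        ∈-concat⁺′ (∈-map⁺ (_▷ proj₂ (es a)) (complete (rec a) P)) (∈-tabulate⁺ a)

      compl : NotSource v → (P : Path v) → P ∈ concat (tabulate group)
      compl ns [ _ ]   = ⊥-elim ns
      compl _  (P ▷ e) = compl′ (proj₁ (es-surj (_ , e))) (_ , e) (proj₂ (es-surj (_ , e))) P

      last∈ : ∀ a {P} → P ∈ group a → lastEdge P ≡ just (es a)
      last∈ a P∈ with _ , _ , refl ← ∈-map⁻ (_▷ proj₂ (es a)) P∈ = refl

      disjoint : ∀ {a b} → a ≢ b → ∀ {P} → ¬ (P ∈ group a × P ∈ group b)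
      disjoint a≢b (P∈a , P∈b) =
        a≢b (es-inj (just-injective (trans (sym (last∈ _ P∈a)) (last∈ _ P∈b))))

    S-index-< : (t : Fin (p ∸ 1)) (l : Fin (p ^ k)) → p ^ k * toℕ t + toℕ l < p ^ k * (p ∸ 1)
    S-index-< t l = subst₂ _<_ (Fin.toℕ-combine t l) (*-comm (p ∸ 1) K) (Fin.toℕ<n (combine t l))

    S-index : Fin (p ∸ 1) → Fin (p ^ k) → Fin (p ^ k * (p ∸ 1))
    S-index t l = fromℕ< (S-index-< t l)

    E1-edge : ∀ l → Fin (p ∸ 1) → ∃ (_⟶ V 1 ≤-refl l)
    E1-edge l t = S (S-index t l) , E1 t l (S-index t l) (Fin.toℕ-fromℕ< (S-index-< t l))

    E1-inj : ∀ l {t t′} → E1-edge l t ≡ E1-edge l t′ → t ≡ t′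
    E1-inj l eq = just-injective (cong label eq)
      where
      label : ∃ (_⟶ V 1 ≤-refl l) → Maybe (Fin (p ∸ 1))
      label (_ , E1 t _ _ _)   = just t
      label (_ , E3 _ _ _ _ _) = nothing

    E1-surj : ∀ l (e : ∃ (_⟶ V 1 ≤-refl l)) → ∃ λ t → E1-edge l t ≡ e
    E1-surj l (_ , E1 t .l i i-eq) = t , same (S-index t l) _ i i-eq
      (Fin.toℕ-injective (trans (Fin.toℕ-fromℕ< (S-index-< t l)) (sym (recompute (_ ≟ _) i-eq))))
      where
      same : ∀ a .(a-eq : toℕ a ≡ p ^ k * toℕ t + toℕ l) b .(b-eq : toℕ b ≡ p ^ k * toℕ t + toℕ l) →
             a ≡ b → _≡_ {A = ∃ (_⟶ V 1 ≤-refl l)} (S a , E1 t l a a-eq) (S b , E1 t l b b-eq)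
      same a _ .a _ refl = refl
    E1-surj l (_ , E3 _ s≥2 _ _ _) = ⊥-elim (2≰1 (recompute (2 ≤? 1) s≥2))

    W-index : (l′ : Fin (p ^ suc k)) → Fin (p ^ k) × Fin p
    W-index l′ = remQuot p (cast (*-comm p K) l′)

    W-index-eq : ∀ l′ → toℕ l′ ≡ p * toℕ (proj₁ (W-index l′)) + toℕ (proj₂ (W-index l′))
    W-index-eq l′ = begin
      toℕ l′                                    ≡⟨ Fin.toℕ-cast (*-comm p K) l′ ⟨
      toℕ (cast (*-comm p K) l′)                ≡⟨ cong toℕ (Fin.combine-remQuot {K} p (cast (*-comm p K) l′)) ⟨
      toℕ (uncurry combine (W-index l′))        ≡⟨ Fin.toℕ-combine (proj₁ (W-index l′)) (proj₂ (W-index l′)) ⟩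
      p * toℕ (proj₁ (W-index l′)) + toℕ (proj₂ (W-index l′)) ∎
      where open ≡-Reasoning

    W-index-unique : ∀ l′ l β → toℕ l′ ≡ p * toℕ l + toℕ β → W-index l′ ≡ (l , β)
    W-index-unique l′ l β eq = trans
      (cong (remQuot p) (Fin.toℕ-injective
        (trans (Fin.toℕ-cast (*-comm p K) l′) (trans eq (sym (Fin.toℕ-combine l β))))))
      (Fin.remQuot-combine l β)

    E2-edge : ∀ s .(s≥1 : 1 ≤ s) l′ → Fin 1 → ∃ (_⟶ W (suc s) (s≤s s≥1) l′)
    E2-edge s s≥1 l′ _ = V s s≥1 (proj₁ (W-index l′)) ,
      E2 s s≥1 (proj₁ (W-index l′)) (proj₂ (W-index l′)) l′ (W-index-eq l′)

    E2-surj : ∀ s .(s≥1 : 1 ≤ s) l′ e → ∃ λ a → E2-edge s s≥1 l′ a ≡ e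
    E2-surj s s≥1 l′ (_ , E2 .s _ l β .l′ eq) = zero ,
      same (W-index l′) (W-index-eq l′) (l , β) eq (W-index-unique l′ l β (recompute (_ ≟ _) eq))
      where
      same : ∀ a .(a-eq : toℕ l′ ≡ p * toℕ (proj₁ a) + toℕ (proj₂ a))
               b .(b-eq : toℕ l′ ≡ p * toℕ (proj₁ b) + toℕ (proj₂ b)) → a ≡ b →
             _≡_ {A = ∃ (_⟶ W (suc s) (s≤s s≥1) l′)}
               (V s s≥1 (proj₁ a) , E2 s s≥1 (proj₁ a) (proj₂ a) l′ a-eq)
               (V s s≥1 (proj₁ b) , E2 s s≥1 (proj₁ b) (proj₂ b) l′ b-eq)
      same a _ .a _ refl = refl

    Fin1 : ∀ {a b : Fin 1} → a ≡ b
    Fin1 {zero} {zero} = refl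

    combine-rem : (t : Fin p) (l : Fin (p ^ k)) →
                  toℕ l ≡ toℕ (combine t l) ∸ p ^ k * (toℕ (combine t l) / p ^ k)
    combine-rem t l = sym (begin
      a ∸ K * (a / K)           ≡⟨ cong (a ∸_) (*-comm K (a / K)) ⟩
      a ∸ (a / K) * K           ≡⟨ m%n≡m∸m/n*n a K ⟨
      a % K                     ≡⟨ cong (_% K) (trans (Fin.toℕ-combine t l) (+-comm (K * toℕ t) _)) ⟩
      (toℕ l + K * toℕ t) % K   ≡⟨ cong (λ z → (toℕ l + z) % K) (*-comm K (toℕ t)) ⟩
      (toℕ l + toℕ t * K) % K   ≡⟨ [m+kn]%n≡m%n (toℕ l) (toℕ t) K ⟩
      toℕ l % K                 ≡⟨ m<n⇒m%n≡m (Fin.toℕ<n l) ⟩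
      toℕ l                     ∎)
      where
      open ≡-Reasoning
      a = toℕ (combine t l)

    E3-edge : ∀ s .(s≥2 : 2 ≤ s) l → Fin p → ∃ (_⟶ V s (<⇒≤ s≥2) l)
    E3-edge s s≥2 l t = W s s≥2 (combine t l) , E3 s s≥2 (combine t l) l (combine-rem t l)

    E3-inj : ∀ s .(s≥2 : 2 ≤ s) l {t t′} → E3-edge s s≥2 l t ≡ E3-edge s s≥2 l t′ → t ≡ t′
    E3-inj s s≥2 l {t} {t′} eq =
      Fin.combine-injectiveˡ t l t′ l (just-injective (cong label eq))
      where
      label : ∃ (_⟶ V s (<⇒≤ s≥2) l) → Maybe (Fin (p ^ suc k))
      label (W _ _ l′ , _) = just l′
      label (S _ , _)      = nothing
      label (V _ _ _ , _)  = nothing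

    E3-surj : ∀ s .(s≥2 : 2 ≤ s) l e → ∃ λ t → E3-edge s s≥2 l t ≡ e
    E3-surj .1 s≥2 l (_ , E1 _ _ _ _) = ⊥-elim (2≰1 (recompute (2 ≤? 1) s≥2))
    E3-surj s s≥2 l (_ , E3 .s _ l′ .l eq) = t , same (combine t l) _ l′ eq
      (trans (cong (combine t) (sym l₂≡l)) (Fin.combine-remQuot {p} K l′))
      where
      t : Fin p
      t = proj₁ (remQuot K l′)
      l₂ : Fin (p ^ k)
      l₂ = proj₂ (remQuot {p} K l′)
      l₂≡l : l₂ ≡ l
      l₂≡l = Fin.toℕ-injective (trans (combine-rem t l₂) (trans
        (cong (λ z → toℕ z ∸ p ^ k * (toℕ z / p ^ k)) (Fin.combine-remQuot {p} K l′))
        (sym (recompute (_ ≟ _) eq))))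
      same : ∀ a .(a-eq : toℕ l ≡ toℕ a ∸ p ^ k * (toℕ a / p ^ k))
               b .(b-eq : toℕ l ≡ toℕ b ∸ p ^ k * (toℕ b / p ^ k)) → a ≡ b →
             _≡_ {A = ∃ (_⟶ V s (<⇒≤ s≥2) l)}
               (W s s≥2 a , E3 s s≥2 a l a-eq) (W s s≥2 b , E3 s s≥2 b l b-eq)
      same a _ .a _ refl = refl

    𝒫S : ∀ i → Enumeration (Path (S i))
    𝒫S i = record
      { list     = [ i ] ∷ []
      ; complete = λ { [ .i ] → here refl ; (_ ▷ ()) }
      ; unique   = All.[] AllPairs.∷ AllPairs.[]
      }

    𝒫V : ∀ s .(s≥1 : 1 ≤ s) l → Enumeration (Path (V s s≥1 l))
    𝒫W : ∀ s .(s≥2 : 2 ≤ s) l′ → Enumeration (Path (W s s≥2 l′))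
    𝒫V zero          s≥1 l = ⊥-elim (1+n≰n (recompute (1 ≤? 0) s≥1))
    𝒫V (suc zero)    _   l = extend tt (E1-edge l) (E1-inj l) (E1-surj l) λ t → 𝒫S (S-index t l)
    𝒫V (suc (suc s)) _   l = extend tt (E3-edge (suc (suc s)) s≥2 l)
      (E3-inj (suc (suc s)) s≥2 l) (E3-surj (suc (suc s)) s≥2 l)
      λ t → 𝒫W (suc (suc s)) s≥2 (combine t l)
      where
      s≥2 : 2 ≤ suc (suc s)
      s≥2 = s≤s (s≤s z≤n)
    𝒫W zero    s≥2 l′ = contradiction (recompute (2 ≤? 0) s≥2) λ ()
    𝒫W (suc s) s≥2 l′ = extend tt (E2-edge s (s≤s⁻¹ s≥2) l′) (λ _ → Fin1)
      (E2-surj s (s≤s⁻¹ s≥2) l′) λ _ → 𝒫V s (s≤s⁻¹ s≥2) (proj₁ (W-index l′))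

  𝒫 : ∀ v → Enumeration (Path v)
  𝒫 (S i)        = 𝒫S i
  𝒫 (V s s≥1 l)  = 𝒫V s s≥1 l
  𝒫 (W s s≥2 l′) = 𝒫W s s≥2 l′

  edge-floor : ∀ {u v} → u ⟶ v → floor v ≡ suc (floor u)
  edge-floor (E1 _ _ _ _) = begin
    2 * (k + 1)       ≡⟨ *-distribˡ-+ 2 k 1 ⟩
    2 * k + 2         ≡⟨ +-suc (2 * k) 1 ⟩
    suc (2 * k + 1)   ∎
    where open ≡-Reasoning
  edge-floor (E2 s _ _ _ _ _) = begin
    2 * (k + suc s) ∸ 1     ≡⟨ cong (λ z → 2 * z ∸ 1) (+-suc k s) ⟩
    2 * suc (k + s) ∸ 1     ≡⟨ cong (_∸ 1) (2[1+s] (k + s)) ⟩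
    suc (2 * (k + s))       ∎
    where open ≡-Reasoning
  edge-floor (E3 s s≥2 _ _ _) = sym (m+[n∸m]≡n {1} {2 * (k + s)}
    (2s≥1 (k + s) (≤-trans (<⇒≤ (recompute (2 ≤? s) s≥2)) (m≤n+m s k))))

  edge-shape : ∀ {u v} (e : u ⟶ v) → shape u ⊕ block e ≈ shape v
  edge-shape {u} {v} e@(E1 t l i i-eq) = ⊕-intro (shape u) (block e) (shape v) size-eq leg-eq
    where
    open ≡-Reasoning
    τ = toℕ t
    t≤ : τ ≤ p ∸ 2
    t≤ = subst (τ ≤_) (pred[m∸n]≡m∸[1+n] p 1) (≤-pred-of (Fin.toℕ<n t))
      where
      ≤-pred-of : ∀ {a b} → a < b → a ≤ pred b
      ≤-pred-of (s≤s q) = q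
    t+r : K * τ + K * (p ∸ 2 ∸ τ) ≡ K * (p ∸ 2)
    t+r = trans (sym (*-distribˡ-+ K τ _)) (cong (K *_) (m+[n∸m]≡n t≤))
    c1 : c 1 ≡ p ∸ 2
    c1 = cong (_∸ 2) (*-identityˡ p)
    size-eq : K * c 2 ≡ K * (p ∸ 1) + (K * τ + K * (p ∸ 2 ∸ τ))
    size-eq = begin
      K * c 2                      ≡⟨ cong (K *_) (c-suc 1 ≤-refl) ⟩
      K * (c 1 + (p ∸ 1))          ≡⟨ cong (λ z → K * (z + (p ∸ 1))) c1 ⟩
      K * (p ∸ 2 + (p ∸ 1))        ≡⟨ cong (K *_) (+-comm (p ∸ 2) _) ⟩
      K * (p ∸ 1 + (p ∸ 2))        ≡⟨ *-distribˡ-+ K (p ∸ 1) _ ⟩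
      K * (p ∸ 1) + K * (p ∸ 2)    ≡⟨ cong (K * (p ∸ 1) +_) t+r ⟨
      K * (p ∸ 1) + (K * τ + K * (p ∸ 2 ∸ τ)) ∎
    leg-eq : x 1 + toℕ l ≡ toℕ i + K * (p ∸ 2 ∸ τ)
    leg-eq = begin
      K * c 1 + toℕ l                        ≡⟨ cong (λ z → K * z + toℕ l) c1 ⟩
      K * (p ∸ 2) + toℕ l                    ≡⟨ cong (_+ toℕ l) t+r ⟨
      K * τ + K * (p ∸ 2 ∸ τ) + toℕ l        ≡⟨ +-assoc (K * τ) _ _ ⟩
      K * τ + (K * (p ∸ 2 ∸ τ) + toℕ l)      ≡⟨ cong (K * τ +_) (+-comm _ (toℕ l)) ⟩
      K * τ + (toℕ l + K * (p ∸ 2 ∸ τ))      ≡⟨ +-assoc (K * τ) _ _ ⟨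
      K * τ + toℕ l + K * (p ∸ 2 ∸ τ)        ≡⟨ cong (_+ K * (p ∸ 2 ∸ τ)) (recompute (_ ≟ _) i-eq) ⟨
      toℕ i + K * (p ∸ 2 ∸ τ)                ∎
  edge-shape {u} {v} e@(E2 s s≥1 l β l′ l′-eq) = ⊕-intro (shape u) (block e) (shape v) size-eq leg-eq
    where
    open ≡-Reasoning
    r = p ∸ 1
    b = r * toℕ l + toℕ β
    β≤r : toℕ β ≤ r
    β≤r = s≤s⁻¹ (subst (toℕ β <_) p≡1+r (Fin.toℕ<n β))
    b≤ : b ≤ K * r
    b≤ = ≤-trans (+-monoʳ-≤ (r * toℕ l) β≤r) (≤-trans
      (≤-reflexive (trans (+-comm (r * toℕ l) r) (sym (*-suc r (toℕ l)))))
      (≤-trans (*-monoʳ-≤ r (Fin.toℕ<n l)) (≤-reflexive (*-comm r K))))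
    size-eq : K * ((2 * suc s ∸ 1) * p ∸ 2 * suc s) ≡ K * c (2 * s) + (K * r ∸ b + b)
    size-eq = begin
      K * ((2 * suc s ∸ 1) * p ∸ 2 * suc s)  ≡⟨ W-size s ⟩
      K * c (suc (2 * s))                    ≡⟨ cong (K *_) (c-suc (2 * s) (2s≥1 s (recompute (1 ≤? s) s≥1))) ⟩
      K * (c (2 * s) + r)                    ≡⟨ *-distribˡ-+ K (c (2 * s)) r ⟩
      K * c (2 * s) + K * r                  ≡⟨ cong (K * c (2 * s) +_) (m∸n+n≡m b≤) ⟨
      K * c (2 * s) + (K * r ∸ b + b)        ∎
    leg-eq : x s + toℕ l′ ≡ x s + toℕ l + b
    leg-eq = begin
      x s + toℕ l′                        ≡⟨ cong (x s +_) (recompute (_ ≟ _) l′-eq) ⟩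
      x s + (p * toℕ l + toℕ β)           ≡⟨ cong (λ z → x s + (z * toℕ l + toℕ β)) p≡1+r ⟩
      x s + (toℕ l + r * toℕ l + toℕ β)   ≡⟨ cong (x s +_) (+-assoc (toℕ l) _ _) ⟩
      x s + (toℕ l + b)                   ≡⟨ +-assoc (x s) _ _ ⟨
      x s + toℕ l + b                     ∎
  edge-shape (E3 zero s≥2 _ _ _) = contradiction (recompute (2 ≤? 0) s≥2) λ ()
  edge-shape {u} {v} e@(E3 (suc s) s≥2 l′ l l-eq) = ⊕-intro (shape u) (block e) (shape v) size-eq leg-eq
    where
    open ≡-Reasoning
    r = p ∸ 1
    t = toℕ l′ / K
    s≥1 : 1 ≤ s
    s≥1 = s≤s⁻¹ (recompute (2 ≤? suc s) s≥2)
    t≤r : t ≤ r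
    t≤r = s≤s⁻¹ (subst (t <_) p≡1+r (m<n*o⇒m/o<n (Fin.toℕ<n l′)))
    t+ : K * t + K * (r ∸ t) ≡ K * r
    t+ = trans (sym (*-distribˡ-+ K t _)) (cong (K *_) (m+[n∸m]≡n t≤r))
    l′-eq : K * t + toℕ l ≡ toℕ l′
    l′-eq = trans (cong (K * t +_) (recompute (_ ≟ _) l-eq))
      (m+[n∸m]≡n (≤-trans (≤-reflexive (*-comm K t)) (m/n*n≤m (toℕ l′) K)))
    size-eq : K * c (2 * suc s) ≡ K * ((2 * suc s ∸ 1) * p ∸ 2 * suc s) + (K * t + K * (r ∸ t))
    size-eq = begin
      K * c (2 * suc s)                     ≡⟨ cong (λ z → K * c z) (2[1+s] s) ⟩
      K * c (suc (suc (2 * s)))             ≡⟨ cong (K *_) (c-suc (suc (2 * s)) (s≤s z≤n)) ⟩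
      K * (c (suc (2 * s)) + r)             ≡⟨ *-distribˡ-+ K (c (suc (2 * s))) r ⟩
      K * c (suc (2 * s)) + K * r           ≡⟨ cong₂ _+_ (W-size s) t+ ⟨
      K * ((2 * suc s ∸ 1) * p ∸ 2 * suc s) + (K * t + K * (r ∸ t)) ∎
    leg-eq : x (suc s) + toℕ l ≡ x s + toℕ l′ + K * (r ∸ t)
    leg-eq = begin
      K * c (suc s) + toℕ l                         ≡⟨ cong (λ z → K * z + toℕ l) (c-suc s s≥1) ⟩
      K * (c s + r) + toℕ l                         ≡⟨ cong (_+ toℕ l) (*-distribˡ-+ K (c s) r) ⟩
      x s + K * r + toℕ l                           ≡⟨ cong (λ z → x s + z + toℕ l) t+ ⟨
      x s + (K * t + K * (r ∸ t)) + toℕ l           ≡⟨ +-assoc (x s) _ _ ⟩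
      x s + (K * t + K * (r ∸ t) + toℕ l)           ≡⟨ cong (x s +_) (+-assoc (K * t) _ _) ⟩
      x s + (K * t + (K * (r ∸ t) + toℕ l))         ≡⟨ cong (λ z → x s + (K * t + z)) (+-comm _ (toℕ l)) ⟩
      x s + (K * t + (toℕ l + K * (r ∸ t)))         ≡⟨ cong (x s +_) (+-assoc (K * t) _ _) ⟨
      x s + (K * t + toℕ l + K * (r ∸ t))           ≡⟨ cong (λ z → x s + (z + K * (r ∸ t))) l′-eq ⟩
      x s + (toℕ l′ + K * (r ∸ t))                  ≡⟨ +-assoc (x s) _ _ ⟨
      x s + toℕ l′ + K * (r ∸ t)                    ∎

{-# OPTIONS --safe #-}

-- Whether (1,2) is an inversion depends only on the parameter t of the first edge, and no other
-- pair involves the block B².  Replacing t by p - 2 - t in the first edge (and moving the source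
-- accordingly) is thus an involution on the paths ending at a given vertex.  Since p - 1 is even,
-- exactly one of t and p - 2 - t is less than (p - 1) / 2, so the involution reverses the sign
-- and the sum cancels.
module Submission where

open import Defs
open import Data.Bool.Base using (false; if_then_else_)
open import Data.Fin.Base using (Fin; toℕ; fromℕ<; combine; opposite)
import Data.Fin.Properties as Fin
open import Data.Integer.Base as ℤ using (ℤ; 0ℤ; -1ℤ; +0)
import Data.Integer.Properties as ℤ
open import Data.List.Base using (List; []; _∷_; map; foldr; filter; length)
open import Data.List.Membership.Propositional using (_∈_)
open import Data.List.Membership.Propositional.Properties using (∈-map⁺; ∈-upTo⁺; ∈-cartesianProduct⁺)
open import Data.List.Membership.Propositional.Properties.WithK using (unique∧set⇒bag)
open import Data.List.Properties using (map-∘; map-cong)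
open import Data.List.Relation.Binary.BagAndSetEquality using (∼bag⇒↭)
open import Data.List.Relation.Binary.Permutation.Propositional using (_↭_; ↭⇒↭ₛ)
import Data.List.Relation.Binary.Permutation.Propositional.Properties as ↭
import Data.List.Relation.Binary.Permutation.Setoid.Properties as ↭ₛ
open import Data.List.Relation.Unary.All using (All; []; _∷_; lookup)
open import Data.List.Relation.Unary.AllPairs using (_∷_)
open import Data.List.Relation.Unary.Any using (here; there)
open import Data.List.Relation.Unary.Unique.Propositional using (Unique)
import Data.List.Relation.Unary.Unique.Propositional.Properties as Unique
open import Data.Nat.Base using (ℕ; suc; _+_; _*_; _∸_; _/_; _%_; _≤_; _<_; _≡ᵇ_; s≤s; _^_)
open import Data.Nat.Divisibility using (_∣_; divides; m%n≡0⇒n∣m)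
open import Data.Nat.DivMod using (m≡m%n+[m/n]*n; m%n<n; m/n*n≡m)
open import Data.Nat.Primality using (Prime; prime⇒nonZero)
open import Data.Nat.Properties
open import Data.Product.Base using (∃; _×_; _,_; uncurry)
open import Data.Sum.Base using (inj₁; inj₂)
open import Function.Base using (_∘_)
open import Function.Bundles using (_⇔_; mk⇔; module Equivalence)
open import Relation.Binary.PropositionalEquality
open import Relation.Nullary using (¬_; yes; no; contradiction)
open import Relation.Nullary.Decidable using (recompute)
open import Relation.Unary using (Decidable)

open Enumeration

-- A nonzero integer and its negation have different constructors, so the hypothesis is empty in
-- every case but `+0`.
i≡-i⇒i≡0 : ∀ {i} → i ≡ ℤ.- i → i ≡ 0ℤ
i≡-i⇒i≡0 {+0} _ = refl

foldr-neg : ∀ {A : Set} (f : A → ℤ) xs →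
            foldr ℤ._+_ 0ℤ (map (ℤ.-_ ∘ f) xs) ≡ ℤ.- foldr ℤ._+_ 0ℤ (map f xs)
foldr-neg f []       = refl
foldr-neg f (x ∷ xs) = trans (cong (λ z → ℤ.- f x ℤ.+ z) (foldr-neg f xs))
  (sym (ℤ.neg-distrib-+ (f x) _))

module _ {A : Set} (xs : Enumeration A) (φ : A → A) (φ-involutive : ∀ x → φ (φ x) ≡ x) where

  -- Both lists are duplicate-free and contain every element of `A`, so they agree as bags.
  involution-↭ : map φ (list xs) ↭ list xs
  involution-↭ = ∼bag⇒↭ (unique∧set⇒bag (Unique.map⁺ φ-injective (unique xs)) (unique xs)
    (mk⇔ (λ _ → complete xs _) (λ _ → subst (_∈ map φ (list xs)) (φ-involutive _)
      (∈-map⁺ φ (complete xs _)))))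
    where
    φ-injective : ∀ {x y} → φ x ≡ φ y → x ≡ y
    φ-injective eq = trans (sym (φ-involutive _)) (trans (cong φ eq) (φ-involutive _))

  -- Reindexing along `φ` turns the sum into its own negative. At a fixed point of `φ` the
  -- hypothesis already forces the value 0.
  ∑-sign-reversing : ∀ f → (∀ x → f (φ x) ≡ ℤ.- f x) → ∑ xs f ≡ 0ℤ
  ∑-sign-reversing f f∘φ≡-f = i≡-i⇒i≡0 (begin
    sum (map f (list xs))           ≡⟨ ↭ₛ.foldr-commMonoid (setoid ℤ) ℤ.+-0-isCommutativeMonoid
                                         (↭⇒↭ₛ (↭.map⁺ f involution-↭)) ⟨
    sum (map f (map φ (list xs)))   ≡⟨ cong sum (map-∘ (list xs)) ⟨
    sum (map (f ∘ φ) (list xs))     ≡⟨ cong sum (map-cong f∘φ≡-f (list xs)) ⟩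
    sum (map (ℤ.-_ ∘ f) (list xs))  ≡⟨ foldr-neg f (list xs) ⟩
    ℤ.- sum (map f (list xs))       ∎)
    where
    open ≡-Reasoning
    sum : List ℤ → ℤ
    sum = foldr ℤ._+_ 0ℤ

module _ {A : Set} {P Q : A → Set} (P? : Decidable P) (Q? : Decidable Q)
         {a : A} (agree : ∀ {x} → a ≢ x → P x ⇔ Q x) where

  open Equivalence

  length-filter-≢ : ∀ {xs} → All (a ≢_) xs → length (filter P? xs) ≡ length (filter Q? xs)
  length-filter-≢ []                   = refl
  length-filter-≢ {x ∷ _} (a≢x ∷ a≢xs) with P? x | Q? x
  ... | yes _  | yes _  = cong suc (length-filter-≢ a≢xs)
  ... | no _   | no _   = length-filter-≢ a≢xs
  ... | yes Px | no ¬Qx = contradiction (to (agree a≢x) Px) ¬Qx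
  ... | no ¬Px | yes Qx = contradiction (from (agree a≢x) Qx) ¬Px

  -- Exactly one of the two filters keeps `a`, which occurs once, and they agree on all other
  -- entries; so the lengths differ by one.
  parity-flip : (P a ⇔ (¬ Q a)) → ∀ {xs} → Unique xs → a ∈ xs →
                -1ℤ ℤ.^ length (filter P? xs) ≡ ℤ.- (-1ℤ ℤ.^ length (filter Q? xs))
  parity-flip differ (a≢xs ∷ _) (here refl) with P? a | Q? a
  ... | yes Pa | yes Qa = contradiction Qa (to differ Pa)
  ... | no ¬Pa | no ¬Qa = contradiction (from differ ¬Qa) ¬Pa
  ... | yes _  | no _   = trans (ℤ.-1*i≡-i _)
    (cong (λ c → ℤ.- (-1ℤ ℤ.^ c)) (length-filter-≢ a≢xs))
  ... | no _   | yes _  = trans (cong (-1ℤ ℤ.^_) (length-filter-≢ a≢xs))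
    (sym (trans (cong ℤ.-_ (ℤ.-1*i≡-i _)) (ℤ.neg-involutive _)))
  parity-flip differ {x ∷ xs} (x≢xs ∷ u) (there a∈xs) with P? x | Q? x
  ... | yes _  | yes _  = trans (cong (-1ℤ ℤ.*_) (parity-flip differ u a∈xs))
    (sym (ℤ.neg-distribʳ-* -1ℤ _))
  ... | no _   | no _   = parity-flip differ u a∈xs
  ... | yes Px | no ¬Qx = contradiction (to (agree (≢-sym (lookup x≢xs a∈xs))) Px) ¬Qx
  ... | no ¬Px | yes Qx = contradiction (from (agree (≢-sym (lookup x≢xs a∈xs))) Qx) ¬Px

odd⇒2∣pred : ∀ n → ¬ 2 ∣ n → 2 ∣ n ∸ 1
odd⇒2∣pred n 2∤n with n % 2 in eq | m≡m%n+[m/n]*n n 2 | m%n<n n 2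
... | 0           | _  | _            = contradiction (m%n≡0⇒n∣m n 2 eq) 2∤n
... | 1           | n≡ | _            = divides (n / 2) (cong (_∸ 1) n≡)
... | suc (suc _) | _  | s≤s (s≤s ())

-- The two values add up to the odd number 2h - 1, so exactly one of them is below h.
opposite-half : ∀ {n} h → n ≡ h * 2 → (t : Fin n) → toℕ t < h ⇔ (¬ toℕ (opposite t) < h)
opposite-half {n} h n≡h*2 t = mk⇔
  (λ t<h o<h → <⇒≱ (+-mono-≤-< t<h o<h) (≤-reflexive (sym sum≡)))
  (λ o≮h → ≰⇒> λ h≤t → <⇒≱ (≤-reflexive sum≡) (+-mono-≤ h≤t (≮⇒≥ o≮h)))
  where
  sum≡ : suc (toℕ t) + toℕ (opposite t) ≡ h + h
  sum≡ = begin
    suc (toℕ t) + toℕ (opposite t)     ≡⟨ cong (suc (toℕ t) +_) (Fin.opposite-prop t) ⟩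
    suc (toℕ t) + (n ∸ suc (toℕ t))    ≡⟨ m+[n∸m]≡n (Fin.toℕ<n t) ⟩
    n                                  ≡⟨ n≡h*2 ⟩
    h * 2                              ≡⟨ *-comm h 2 ⟩
    h + (h + 0)                        ≡⟨ cong (h +_) (+-identityʳ h) ⟩
    h + h                              ∎
    where open ≡-Reasoning

-- The Boolean form lets a rewrite reduce the `if` in `blockAt`.
2≢ᵇ : ∀ {n} → 2 < n → (2 ≡ᵇ n) ≡ false
2≢ᵇ (s≤s (s≤s (s≤s _))) = refl

module _ (p : ℕ) (p-prime : Prime p) (p-odd : ¬ 2 ∣ p) (k : ℕ) where

  open Column p p-prime p-odd k

  source-< : (t : Fin (p ∸ 1)) (l : Fin (p ^ k)) → p ^ k * toℕ t + toℕ l < p ^ k * (p ∸ 1)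
  source-< t l = subst₂ _<_ (Fin.toℕ-combine t l) (*-comm (p ∸ 1) (p ^ k)) (Fin.toℕ<n (combine t l))

  startAt : ∀ l → Fin (p ∸ 1) → Path (V 1 ≤-refl l)
  startAt l t = [ fromℕ< (source-< t l) ] ▷ E1 t l _ (Fin.toℕ-fromℕ< (source-< t l))

  -- The edge condition determines `i` from `t` and `l`, and its proof is irrelevant.
  startAt-unique : ∀ t l i .(eq : toℕ i ≡ p ^ k * toℕ t + toℕ l) → startAt l t ≡ [ i ] ▷ E1 t l i eq
  startAt-unique t l i eq = same (fromℕ< (source-< t l)) _ i eq
    (Fin.toℕ-injective (trans (Fin.toℕ-fromℕ< (source-< t l)) (sym (recompute (_ ≟ _) eq))))
    where
    -- Both indices are variables here, so matching on `refl` can identify them.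
    same : ∀ a .(a-eq : toℕ a ≡ p ^ k * toℕ t + toℕ l) b .(b-eq : toℕ b ≡ p ^ k * toℕ t + toℕ l) →
           a ≡ b → [ a ] ▷ E1 t l a a-eq ≡ [ b ] ▷ E1 t l b b-eq
    same a _ .a _ refl = refl

  -- On `Fin (p ∸ 1)`, `opposite` is the map from t to p - 2 - t. The vertex `V 1 _ l` and
  -- everything above it stay in place; a path without edges is fixed.
  reflect : ∀ {v} → Path v → Path v
  reflect [ i ]                    = [ i ]
  reflect (_ ▷ E1 t l _ _)         = startAt l (opposite t)
  reflect (P ▷ e@(E2 _ _ _ _ _ _)) = reflect P ▷ e
  reflect (P ▷ e@(E3 _ _ _ _ _))   = reflect P ▷ e

  reflect-involutive : ∀ {v} (P : Path v) → reflect (reflect P) ≡ P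
  reflect-involutive [ i ]                    = refl
  reflect-involutive ([ i ] ▷ E1 t l .i eq)   =
    trans (cong (startAt l) (Fin.opposite-involutive t)) (startAt-unique t l i eq)
  -- No edge ends at a source, so only a one-vertex path can precede `E1`.
  reflect-involutive ((_ ▷ ()) ▷ E1 _ _ _ _)
  reflect-involutive (P ▷ e@(E2 _ _ _ _ _ _)) = cong (_▷ e) (reflect-involutive P)
  reflect-involutive (P ▷ e@(E3 _ _ _ _ _))   = cong (_▷ e) (reflect-involutive P)

  -- Only the `E1` edge changes, and its block has number 2.
  blockAt-reflect : ∀ {v} (P : Path v) {j} → 3 ≤ j → blockAt (reflect P) j ≡ blockAt P j
  blockAt-reflect [ i ] _ = refl
  -- Matching on the bound makes the test against 2 fail, leaving the dummy block on both sides.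
  blockAt-reflect ([ i ] ▷ E1 _ _ _ _) (s≤s (s≤s (s≤s _))) = refl
  blockAt-reflect ((_ ▷ ()) ▷ E1 _ _ _ _)
  blockAt-reflect (_▷_ {v = v} P e@(E2 _ _ _ _ _ _)) {j} 3≤j =
    cong (if j ≡ᵇ number v then block e else_) (blockAt-reflect P 3≤j)
  blockAt-reflect (_▷_ {v = v} P e@(E3 _ _ _ _ _)) {j} 3≤j =
    cong (if j ≡ᵇ number v then block e else_) (blockAt-reflect P 3≤j)

  m₂-append : ∀ {u v} (P : Path u) (e : u ⟶ v) → 2 < number v → m (P ▷ e) 2 ≡ m P 2
  m₂-append P e 2<v rewrite 2≢ᵇ 2<v = refl

  -- The bound on `number v` excludes paths without edges. Every edge after `E1` has a block number
  -- above 2 and leaves the second block alone.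
  firstEdge : ∀ {v} (P : Path v) → 2 ≤ number v → ∃ λ (t : Fin (p ∸ 1)) →
              m P 2 ≡ p ^ k * toℕ t × m (reflect P) 2 ≡ p ^ k * toℕ (opposite t)
  firstEdge [ _ ] (s≤s ())
  firstEdge (_ ▷ E1 t _ _ _) _ = t , refl , refl
  firstEdge (P ▷ e@(E2 s s≥1 _ _ _ _)) _ =
    let t , eq , eq′ = firstEdge P (*-monoʳ-≤ 2 1≤s)
    in  t , trans (m₂-append P e 3≤N) eq , trans (m₂-append (reflect P) e 3≤N) eq′
    where
    1≤s : 1 ≤ s
    1≤s = recompute (1 ≤? s) s≥1
    3≤N : 3 ≤ 2 * suc s ∸ 1
    3≤N = ∸-monoˡ-≤ 1 (*-monoʳ-≤ 2 (s≤s 1≤s))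
  firstEdge (P ▷ e@(E3 s s≥2 _ _ _)) _ =
    let t , eq , eq′ = firstEdge P (≤-trans (n≤1+n 2) (∸-monoˡ-≤ 1 4≤2s))
    in  t , trans (m₂-append P e 3≤N) eq , trans (m₂-append (reflect P) e 3≤N) eq′
    where
    4≤2s : 4 ≤ 2 * s
    4≤2s = *-monoʳ-≤ 2 (recompute (2 ≤? s) s≥2)
    3≤N : 3 ≤ 2 * s
    3≤N = ≤-trans (n≤1+n 3) 4≤2s

  -- The witness in the inversion equals `toℕ t` after cancelling the nonzero factor `p ^ k`; the
  -- general clause would demand 3 ≤ 1.
  Inv₁₂-⇔ : ∀ {v} (P : Path v) (t : Fin (p ∸ 1)) → 2 ≤ number v → m P 2 ≡ p ^ k * toℕ t →
            Inv P 1 2 ⇔ toℕ t < (p ∸ 1) / 2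
  Inv₁₂-⇔ P t 2≤N m₂≡ = mk⇔
    (λ { (inj₁ (_ , _ , _ , t′ , t′<h , m₂≡′)) →
           subst (_< (p ∸ 1) / 2) (*-cancelˡ-≡ t′ (toℕ t) (p ^ k) (trans (sym m₂≡′) m₂≡)) t′<h
       ; (inj₂ (s≤s () , _)) })
    (λ t<h → inj₁ (refl , refl , 2≤N , toℕ t , t<h , m₂≡))
    where
    instance
      pᵏ≢0 = m^n≢0 p k {{prime⇒nonZero p-prime}}

  -- Away from (1,2) only the general clause can apply, and it compares blocks with numbers at least
  -- 3. Swapping `P` and `Q` gives the converse.
  Inv-≢ : ∀ {v} (P Q : Path v) → (∀ {j} → 3 ≤ j → blockAt P j ≡ blockAt Q j) →
          ∀ {i j} → (1 , 2) ≢ (i , j) → Inv P i j → Inv Q i j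
  Inv-≢ P Q eq ≢ij (inj₁ (refl , refl , _)) = contradiction refl ≢ij
  Inv-≢ P Q eq {i} {j} ≢ij (inj₂ (3≤i , i<j , j≤N , m> , n<)) =
    inj₂ (3≤i , i<j , j≤N
         , subst₂ _<_ (cong Block.horizontal (eq 3≤j)) (cong Block.horizontal (eq 3≤i)) m>
         , subst₂ _<_ (cong Block.vertical (eq 3≤i)) (cong Block.vertical (eq 3≤j)) n<)
    where
    3≤j : 3 ≤ j
    3≤j = ≤-trans 3≤i (<⇒≤ i<j)

  sign-reflect : ∀ {v} (P : Path v) → 2 ≤ number v → sign (reflect P) ≡ ℤ.- sign P
  sign-reflect {v} P 2≤N = parity-flip (uncurry (inv? (reflect P))) (uncurry (inv? P))
    (λ ≢ij → mk⇔ (Inv-≢ (reflect P) P (blockAt-reflect P) ≢ij)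
                 (Inv-≢ P (reflect P) (sym ∘ blockAt-reflect P) ≢ij))
    differ
    (Unique.cartesianProduct⁺ (Unique.upTo⁺ N+1) (Unique.upTo⁺ N+1))
    -- The indices run from 0 to N, so 2 ≤ N puts the pair (1,2) in the list.
    (∈-cartesianProduct⁺ (∈-upTo⁺ (s≤s (<⇒≤ 2≤N))) (∈-upTo⁺ (s≤s 2≤N)))
    where
    open Equivalence

    N+1 : ℕ
    N+1 = suc (number v)

    -- Oddness of `p` makes the halving exact, as `opposite-half` requires.
    p-1≡h*2 : p ∸ 1 ≡ (p ∸ 1) / 2 * 2
    p-1≡h*2 = sym (m/n*n≡m (odd⇒2∣pred p p-odd))

    differ : Inv (reflect P) 1 2 ⇔ (¬ Inv P 1 2)
    differ with t , m₂≡ , m₂′≡ ← firstEdge P 2≤N = mk⇔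
      (λ I′ I → to half (to P⇔ I) (to P′⇔ I′))
      (λ ¬I → from P′⇔ (≰⇒> λ h≤t′ → ¬I (from P⇔ (from half (≤⇒≯ h≤t′)))))
      where
      P⇔ = Inv₁₂-⇔ P t 2≤N m₂≡
      P′⇔ = Inv₁₂-⇔ (reflect P) (opposite t) 2≤N m₂′≡
      half = opposite-half _ p-1≡h*2 t

  ∑-sign≡0 : ∀ v → 2 ≤ number v → ∑ (𝒫 v) sign ≡ 0ℤ
  ∑-sign≡0 v 2≤N = ∑-sign-reversing (𝒫 v) reflect reflect-involutive sign (λ P → sign-reflect P 2≤N)

mainTheorem1 : (p : ℕ) (p-prime : Prime p) (p-odd : ¬ 2 ∣ p) (k : ℕ) →
    let open Column p p-prime p-odd k in
    (s : ℕ) (s≥1 : 1 ≤ s) (l : Fin (p ^ k)) (l′ : Fin (p ^ suc k)) →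
    ∑ (𝒫 (V s s≥1 l)) sign ≡ 0ℤ × ∑ (𝒫 (W (suc s) (s≤s s≥1) l′)) sign ≡ 0ℤ
mainTheorem1 p p-prime p-odd k s s≥1 l l′ =
    ∑-sign≡0 p p-prime p-odd k (V s s≥1 l) (*-monoʳ-≤ 2 s≥1)
  , ∑-sign≡0 p p-prime p-odd k (W (suc s) (s≤s s≥1) l′)
      (≤-trans (n≤1+n 2) (∸-monoˡ-≤ 1 (*-monoʳ-≤ 2 (s≤s s≥1))))
  where open Column p p-prime p-odd k
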